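{- The longest overlap-free word over the ternary alphabet $\{0,1,2\}$ whose curling-number transform is overlap-free has length $84$. That is, there exists an overlap-free ternary word $x$ of length $84$ with $C(x)$ overlap-free, and there is no such word of length greater than $84$.
   Context: Words are indexed from $0$: a finite word of length $n$ is $x = x[0]x[1]\cdots x[n-1]$, and $x[i..j]$ denotes the factor (contiguous block) $x[i]\cdots x[j]$. An overlap is a word of the form $a x a x a$ with $a$ a single letter and $x$ a possibly empty word; a word is overlap-free if it contains no overlap as a factor. The curling number of a nonempty finite word $u$ is the largest integer $k \ge 1$ such that $u = y z^k$ for some (possibly empty) word $y$ and some nonempty word $z$. For a finite or infinite word $x$, the curling-number transform $C(x)$ is the word over the positive integers, of the same length as $x$, whose $i$-th letter $C(x)[i]$ is the curling number of the prefix $x[0..i]$. -}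

module Defs where

open import Data.Fin.Base using (toℕ)
open import Data.List.Base using (List; []; _∷_; _++_; length; concat; replicate; take; tabulate)
open import Data.List.Properties using (≡-dec; length-++; ++-identityʳ)
open import Data.List.Relation.Binary.Infix.Heterogeneous using (Infix)
open import Data.Nat.Base using (ℕ; zero; suc; _≤_; z≤n; s≤s)
open import Data.Nat.Properties using (≤-reflexive; ≤-trans; m≤n+m; +-mono-≤; m≤n⇒m<n∨m≡n; ≤-pred)
open import Data.Product.Base using (∃; ∃₂; _×_; _,_)
open import Data.Sum.Base using (inj₁; inj₂)
open import Level using (Level)
open import Relation.Binary.Definitions using (DecidableEquality)
open import Relation.Binary.PropositionalEquality using (_≡_; _≢_; refl; sym)
open import Relation.Nullary.Decidable using (Dec; yes; no; ¬?; _×-dec_; map′)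
open import Relation.Nullary.Negation using (¬_; contradiction)

private
  variable
    a p : Level
    A : Set a

Overlap : List A → Set _
Overlap w = ∃₂ λ b x → w ≡ (b ∷ x) ++ (b ∷ x) ++ (b ∷ [])

OverlapFree : List A → Set _
OverlapFree u = ¬ (∃ λ w → Overlap w × Infix _≡_ w u)

power : List A → ℕ → List A
power z k = concat (replicate k z)

EndsInPower : List A → ℕ → Set _
EndsInPower u k = ∃₂ λ y z → z ≢ [] × u ≡ y ++ power z k

IsCurlingNumber : List A → ℕ → Set _
IsCurlingNumber u k = 1 ≤ k × EndsInPower u k × (∀ j → EndsInPower u j → j ≤ k)

private
  split? : {Q : List A → List A → Set p} → (∀ y w → Dec (Q y w)) →
           ∀ u → Dec (∃₂ λ y w → u ≡ y ++ w × Q y w)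
  split? Q? [] = map′ (λ q → [] , [] , refl , q)
                      (λ { ([] , [] , refl , q) → q })
                      (Q? [] [])
  split? Q? (b ∷ u) with Q? [] (b ∷ u)
  ... | yes q = yes ([] , b ∷ u , refl , q)
  ... | no ¬q with split? (λ y → Q? (b ∷ y)) u
  ...   | yes (y , w , refl , q) = yes (b ∷ y , w , refl , q)
  ...   | no ¬s = no λ { ([] , _ , refl , q)     → ¬q q
                       ; (_ ∷ y , w , refl , q) → ¬s (y , w , refl , q) }

-- Restricted to positive exponents: if k = 0 were allowed, deciding this
-- would require deciding whether A is inhabited.
endsInPower? : DecidableEquality A → (u : List A) → ∀ k → Dec (EndsInPower u (suc k))
endsInPower? {A = A} _≟_ u k =
  map′ (λ { (y , w , eq , z , _ , refl , z≢[] , refl) → y , z , z≢[] , eq })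
       (λ { (y , z , z≢[] , eq) → y , _ , eq , z , _ , refl , z≢[] , refl })
       (split? (λ _ → split? λ z r → ¬? (z ≟* []) ×-dec (r ≟* power z k)) u)
  where
  _≟*_ : DecidableEquality (List A)
  _≟*_ = ≡-dec _≟_

-- The largest k with 1 ≤ k ≤ n satisfying P, or 0 if there is none.
largest : (P : ℕ → Set p) → (∀ k → Dec (P (suc k))) → ℕ → ℕ
largest P P? zero = 0
largest P P? (suc n) with P? n
... | yes _ = suc n
... | no  _ = largest P P? n

-- An exponent k in u = y z^k with z nonempty is at most the length of u, so
-- the search bound loses nothing; see curlingNumber-correct.
curlingNumber : DecidableEquality A → List A → ℕ
curlingNumber _≟_ u = largest (EndsInPower u) (endsInPower? _≟_ u) (length u)

curlingTransform : DecidableEquality A → List A → List ℕ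
curlingTransform _≟_ x =
  tabulate {n = length x} λ i → curlingNumber _≟_ (take (suc (toℕ i)) x)

private
  largest-upper : (P : ℕ → Set p) (P? : ∀ k → Dec (P (suc k))) →
                  ∀ n j → j ≤ n → P j → j ≤ largest P P? n
  largest-upper P P? n zero _ _ = z≤n
  largest-upper P P? (suc n) (suc j) j≤n Pj with P? n
  ... | yes _ = j≤n
  ... | no ¬p with m≤n⇒m<n∨m≡n j≤n
  ...   | inj₁ j<n  = largest-upper P P? n (suc j) (≤-pred j<n) Pj
  ...   | inj₂ refl = contradiction Pj ¬p

  largest-satisfies : (P : ℕ → Set p) (P? : ∀ k → Dec (P (suc k))) →
                      ∀ n → 1 ≤ largest P P? n → P (largest P P? n)
  largest-satisfies P P? (suc n) pos with P? n
  ... | yes p = p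
  ... | no  _ = largest-satisfies P P? n pos

  length-nonempty : (z : List A) → z ≢ [] → 1 ≤ length z
  length-nonempty []      z≢[] = contradiction refl z≢[]
  length-nonempty (_ ∷ _) _    = s≤s z≤n

  power-length : (z : List A) → z ≢ [] → ∀ k → k ≤ length (power z k)
  power-length z z≢[] zero    = z≤n
  power-length z z≢[] (suc k) =
    ≤-trans (+-mono-≤ (length-nonempty z z≢[]) (power-length z z≢[] k))
            (≤-reflexive (sym (length-++ z)))

  exponent-bound : (u : List A) → ∀ k → EndsInPower u k → k ≤ length u
  exponent-bound _ k (y , z , z≢[] , refl) =
    ≤-trans (power-length z z≢[] k)
            (≤-trans (m≤n+m _ (length y)) (≤-reflexive (sym (length-++ y))))

curlingNumber-correct : (_≟_ : DecidableEquality A) (u : List A) → u ≢ [] →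
                        IsCurlingNumber u (curlingNumber _≟_ u)
curlingNumber-correct _≟_ u u≢[] =
  positive , largest-satisfies (EndsInPower u) (endsInPower? _≟_ u) (length u) positive , upper
  where
  upper : ∀ j → EndsInPower u j → j ≤ curlingNumber _≟_ u
  upper j e = largest-upper (EndsInPower u) (endsInPower? _≟_ u) (length u) j (exponent-bound u j e) e

  positive : 1 ≤ curlingNumber _≟_ u
  positive = upper 1 ([] , u , u≢[] , sym (++-identityʳ u))

{-# OPTIONS --safe #-}

-- An overlap-free word has no suffix that is a cube, so its curling numbers
-- are 1 and 2, the letter 2 marking the prefixes that end in a square. Both
-- conditions pass to prefixes and are invariant under renaming the letters, so
-- it suffices to backtrack over the words that begin with 01 or 001. The search
-- tree has about 170000 nodes and is empty at depth 85.
module Submission where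

open import Data.Bool using (Bool; true; false; _∧_; _∨_; if_then_else_)
open import Data.Fin using (Fin; toℕ; _≟_)
open import Data.Fin.Patterns using (0F; 1F; 2F)
open import Data.Fin.Permutation using (Permutation′; transpose; _∘ₚ_; _⟨$⟩ʳ_; _⟨$⟩ˡ_; inverseˡ)
open import Data.Fin.Properties using (all?)
open import Data.List using (List; []; _∷_; [_]; _++_; _∷ʳ_; _ʳ++_; length; map; reverse; take; drop; tabulate)
open import Data.List.Membership.Propositional using (_∈_; _∉_)
import Data.List.Membership.DecPropositional as DecMembership
open import Data.List.Properties
open import Data.List.Relation.Binary.Infix.Heterogeneous using (Infix; MkView; toView; fromView)
open import Data.List.Relation.Binary.Pointwise using (Pointwise-≡⇒≡; ≡⇒Pointwise-≡)
open import Data.List.Relation.Binary.Prefix.Heterogeneous as Prefix using (Prefix)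
open import Data.List.Relation.Unary.Any using (here; there)
open import Data.Nat using (ℕ; zero; suc; _+_; _≤_; _<_; z≤n; s≤s)
import Data.Nat as ℕ
open import Data.Nat.Properties using (≤-refl; ≤-trans; ≤-reflexive; ≤-antisym; ≮⇒≥; +-mono-≤; +-monoʳ-≤; +-suc; m≤m+n; n≤1+n; m≤n⇒m⊓n≡m; suc-injective; 1+n≰n; +-identityʳ)
open import Data.Product using (∃; ∃₂; _×_; _,_; proj₁; proj₂; uncurry)
open import Function using (_∘_)
open import Relation.Binary using (DecidableEquality)
open import Relation.Binary.PropositionalEquality using (_≡_; _≢_; refl; sym; trans; cong; cong₂; subst; module ≡-Reasoning)
open import Relation.Nullary using (¬_; Dec; yes; no; does; contradiction)
open import Relation.Nullary.Decidable using (¬?; _×-dec_; _→-dec_; map′; from-yes)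
open import Defs

private
  variable
    A B C : Set
    a : A
    u v w : List A
    j k n : ℕ

-- Factors and overlaps

prefix⇒++ : Prefix _≡_ w u → ∃ λ s → u ≡ w ++ s
prefix⇒++ pre with Prefix.toView pre
... | w≈w′ Prefix.++ s with refl ← Pointwise-≡⇒≡ w≈w′ = s , refl

infix-++ : ∀ (p : List A) {w} s → u ≡ p ++ w ++ s → Infix _≡_ w u
infix-++ p s refl = fromView (MkView p (≡⇒Pointwise-≡ refl) s)

infix⇒++ : Infix _≡_ w u → ∃₂ λ p s → u ≡ p ++ w ++ s
infix⇒++ inf with toView inf
... | MkView p w≈w′ s with refl ← Pointwise-≡⇒≡ w≈w′ = p , s , refl

overlapFree-++ˡ : ∀ (u : List A) {v} → OverlapFree (u ++ v) → OverlapFree u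
overlapFree-++ˡ u {v} free (w , ov , inf) with p , s , refl ← infix⇒++ inf =
  free (w , ov , infix-++ p (s ++ v) (trans (++-assoc p (w ++ s) v) (cong (p ++_) (++-assoc w s v))))

overlapFree-tail : OverlapFree (a ∷ w) → OverlapFree w
overlapFree-tail free (w , ov , inf) = free (w , ov , Infix.there inf)

-- The reverse of a x a x a has the same shape, with x reversed. This lets the search store words
-- backwards.
overlap-reverse : Overlap w → Overlap (reverse w)
overlap-reverse (b , x , refl) = b , reverse x , (begin
  reverse (z ++ z ++ [ b ])                     ≡⟨ reverse-++ z (z ++ [ b ]) ⟩
  reverse (z ++ [ b ]) ++ reverse z             ≡⟨ cong₂ _++_ (reverse-++ z [ b ]) (unfold-reverse b x) ⟩
  (b ∷ reverse z) ++ (reverse x ∷ʳ b)           ≡⟨ cong (λ y → (b ∷ y) ++ reverse x ∷ʳ b) (unfold-reverse b x) ⟩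
  (b ∷ reverse x ∷ʳ b) ++ (reverse x ∷ʳ b)      ≡⟨ cong (b ∷_) (++-assoc (reverse x) [ b ] (reverse x ∷ʳ b)) ⟩
  (b ∷ reverse x) ++ (b ∷ reverse x) ++ [ b ]   ∎)
  where
  open ≡-Reasoning
  z = b ∷ x

overlapFree-reverse : OverlapFree u → OverlapFree (reverse u)
overlapFree-reverse {u = u} free (w , ov , inf) with p , s , eq ← infix⇒++ inf =
  free (reverse w , overlap-reverse ov , infix-++ (reverse s) (reverse p) (begin
    u                                      ≡⟨ reverse-involutive u ⟨
    reverse (reverse u)                    ≡⟨ cong reverse eq ⟩
    reverse (p ++ w ++ s)                  ≡⟨ reverse-++ p (w ++ s) ⟩
    reverse (w ++ s) ++ reverse p          ≡⟨ cong (_++ reverse p) (reverse-++ w s) ⟩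
    (reverse s ++ reverse w) ++ reverse p  ≡⟨ ++-assoc (reverse s) (reverse w) (reverse p) ⟩
    reverse s ++ reverse w ++ reverse p    ∎))
  where open ≡-Reasoning

overlapFree-reverse⁻ : OverlapFree (reverse u) → OverlapFree u
overlapFree-reverse⁻ {u = u} free = subst OverlapFree (reverse-involutive u) (overlapFree-reverse free)

-- A letter map sends a x a x a to a word of the same shape, so an overlap in `u` would survive in
-- the image.
overlapFree-map⁻ : (f : A → B) → OverlapFree (map f u) → OverlapFree u
overlapFree-map⁻ {u = u} f free (_ , (b , x , refl) , inf) with p , s , refl ← infix⇒++ inf =
  free (_ , (f b , map f x , refl) , infix-++ (map f p) (map f s) (begin
    map f (p ++ o ++ s)                                    ≡⟨ map-++ f p (o ++ s) ⟩
    map f p ++ map f (o ++ s)                              ≡⟨ cong (map f p ++_) (map-++ f o s) ⟩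
    map f p ++ map f o ++ map f s                          ≡⟨ cong (λ y → map f p ++ y ++ map f s) map-o ⟩
    map f p ++ (map f z ++ map f z ++ [ f b ]) ++ map f s  ∎))
  where
  open ≡-Reasoning
  z = b ∷ x
  o = z ++ z ++ [ b ]
  map-o : map f o ≡ map f z ++ map f z ++ [ f b ]
  map-o = trans (map-++ f z _) (cong (map f z ++_) (map-++ f z [ b ]))

-- Curling numbers

-- One copy of `z` is absorbed into `y`.
endsInPower-pred : ∀ k → EndsInPower u (suc k) → EndsInPower u k
endsInPower-pred k (y , z , z≢[] , eq) =
  y ++ z , z , z≢[] , trans eq (sym (++-assoc y z (power z k)))

endsInPower-square : ∀ j → EndsInPower u (2 + j) → EndsInPower u 2
endsInPower-square zero    e = e
endsInPower-square (suc j) e = endsInPower-square j (endsInPower-pred (2 + j) e)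

-- If `z` begins with the letter b, then the cube z z z begins with z z b, which is an overlap.
overlapFree⇒cubeFree : OverlapFree u → ∀ j → ¬ EndsInPower u (3 + j)
overlapFree⇒cubeFree free j (y , []    , z≢[] , eq) = z≢[] refl
overlapFree⇒cubeFree free j (y , b ∷ s , _    , eq) =
  free (_ , (b , s , refl) , infix-++ y (s ++ power z j) (trans eq (cong (y ++_) (begin
    z ++ z ++ z ++ power z j                ≡⟨ cong (z ++_) (++-assoc z [ b ] _) ⟨
    z ++ (z ++ [ b ]) ++ s ++ power z j     ≡⟨ ++-assoc z (z ++ [ b ]) _ ⟨
    (z ++ z ++ [ b ]) ++ s ++ power z j     ∎))))
  where
  open ≡-Reasoning
  z = b ∷ s

isCurlingNumber-unique : IsCurlingNumber u j → IsCurlingNumber u k → j ≡ k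
isCurlingNumber-unique (_ , ej , max-j) (_ , ek , max-k) = ≤-antisym (max-k _ ej) (max-j _ ek)

overlapFree-square⇒2 : OverlapFree u → EndsInPower u 2 → IsCurlingNumber u 2
overlapFree-square⇒2 {u = u} free e = s≤s z≤n , e , max
  where
  max : ∀ j → EndsInPower u j → j ≤ 2
  max 0                   _  = z≤n
  max 1                   _  = s≤s z≤n
  max 2                   _  = s≤s (s≤s z≤n)
  max (suc (suc (suc j))) e′ = contradiction e′ (overlapFree⇒cubeFree free j)

nonsquare⇒1 : u ≢ [] → ¬ EndsInPower u 2 → IsCurlingNumber u 1
nonsquare⇒1 {u = u} u≢[] ¬e = s≤s z≤n , ([] , u , u≢[] , sym (++-identityʳ u)) , max
  where
  max : ∀ j → EndsInPower u j → j ≤ 1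
  max 0             _  = z≤n
  max 1             _  = s≤s z≤n
  max (suc (suc j)) e′ = contradiction (endsInPower-square j e′) ¬e

-- Renaming of letters and passage to prefixes

power-map : (f : A → B) (z : List A) (k : ℕ) → map f (power z k) ≡ power (map f z) k
power-map f z zero    = refl
power-map f z (suc k) = trans (map-++ f z (power z k)) (cong (map f z ++_) (power-map f z k))

endsInPower-map : (f : A → B) → ∀ k → EndsInPower u k → EndsInPower (map f u) k
endsInPower-map f k (y , z , z≢[] , refl) =
  map f y , map f z , (λ eq → z≢[] (map-≡[] z eq)) ,
  trans (map-++ f y _) (cong (map f y ++_) (power-map f z k))
  where
  map-≡[] : ∀ z → map f z ≡ [] → z ≡ []
  map-≡[] [] _ = refl

map-inverse : {f : A → B} {g : B → A} → (∀ c → g (f c) ≡ c) → ∀ u → map g (map f u) ≡ u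
map-inverse gf u = trans (sym (map-∘ u)) (trans (map-cong gf u) (map-id u))

-- Powers at the end of `u` are carried forward by `f`, and those at the end of `map f u` are
-- carried back by its left inverse `g`, so the same exponents occur.
curlingNumber-map : (_≟ᴬ_ : DecidableEquality A) (_≟ᴮ_ : DecidableEquality B)
                    {f : A → B} {g : B → A} → (∀ c → g (f c) ≡ c) →
                    ∀ u → curlingNumber _≟ᴮ_ (map f u) ≡ curlingNumber _≟ᴬ_ u
curlingNumber-map _≟ᴬ_ _≟ᴮ_ gf [] = refl
curlingNumber-map _≟ᴬ_ _≟ᴮ_ {f} {g} gf u@(_ ∷ _) =
  isCurlingNumber-unique (curlingNumber-correct _≟ᴮ_ (map f u) λ ())
    (let 1≤k , e , max = curlingNumber-correct _≟ᴬ_ u λ () in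
     1≤k , endsInPower-map f (curlingNumber _≟ᴬ_ u) e ,
     λ j e′ → max j (subst (λ v → EndsInPower v j) (map-inverse gf u) (endsInPower-map g j e′)))

-- `curlingTransform` with the function of the prefix abstracted: inductions can then strip the
-- first letter by moving it into `h`.
prefixwise : (List A → B) → List A → List B
prefixwise h x = tabulate {n = length x} λ i → h (take (suc (toℕ i)) x)

prefixwise-++ : (h : List A → B) → ∀ u v → prefixwise h (u ++ v) ≡ prefixwise h u ++ prefixwise (h ∘ (u ++_)) v
prefixwise-++ h []      v = refl
prefixwise-++ h (a ∷ u) v = cong (h [ a ] ∷_) (prefixwise-++ (h ∘ (a ∷_)) u v)

prefixwise-map : (h : List B → C) (f : A → B) → ∀ u → prefixwise h (map f u) ≡ prefixwise (h ∘ map f) u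
prefixwise-map h f []      = refl
prefixwise-map h f (a ∷ u) = cong (h [ f a ] ∷_) (prefixwise-map (h ∘ (f a ∷_)) f u)

Good : List (Fin 3) → Set
Good x = OverlapFree x × OverlapFree (curlingTransform _≟_ x)

-- The transform of a prefix is a prefix of the transform, because each of its letters depends only
-- on the word up to that position.
good-++ˡ : ∀ u {v} → Good (u ++ v) → Good u
good-++ˡ u {v} (free , freeC) =
  overlapFree-++ˡ u free ,
  overlapFree-++ˡ (curlingTransform _≟_ u)
    (subst OverlapFree (prefixwise-++ (curlingNumber _≟_) u v) freeC)

curlingTransform-map : {f g : Fin 3 → Fin 3} → (∀ c → g (f c) ≡ c) →
                       ∀ u → curlingTransform _≟_ (map f u) ≡ curlingTransform _≟_ u
curlingTransform-map {f} {g} gf u =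
  trans (prefixwise-map (curlingNumber _≟_) f u)
        (tabulate-cong λ i → curlingNumber-map _≟_ _≟_ {f} {g} gf (take (suc (toℕ i)) u))

good-map : {f g : Fin 3 → Fin 3} → (∀ c → g (f c) ≡ c) → Good u → Good (map f u)
good-map {u = u} {f} {g} gf (free , freeC) =
  overlapFree-map⁻ g (subst OverlapFree (sym (map-inverse gf u)) free) ,
  subst OverlapFree (sym (curlingTransform-map {f} {g} gf u)) freeC

-- Squares and overlaps at the head of a word

++-injective : ∀ (p q : List A) {s t} → length p ≡ length q → p ++ s ≡ q ++ t → p ≡ q × s ≡ t
++-injective []      []      _ eq = refl , eq
++-injective (a ∷ p) (b ∷ q) l eq with refl , eq′ ← ∷-injective eq
  with refl , eq″ ← ++-injective p q (suc-injective l) eq′ = refl , eq″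

module HeadRepetitions {A : Set} (_≟ᴬ_ : DecidableEquality A) where

  open DecMembership _≟ᴬ_ public using (_∈?_)

  agree : ℕ → List A → List A → Bool
  agree zero    _       _       = true
  agree (suc k) []      _       = false
  agree (suc k) (_ ∷ _) []      = false
  agree (suc k) (x ∷ u) (y ∷ v) = does (x ≟ᴬ y) ∧ agree k u v

  -- The letters a with v = r a t for some r shorter than n such that w and t
  -- agree on their first k + |r| letters. For v = w these are the letters a
  -- such that a w begins with a square (k = 0) or an overlap (k = 1) of period
  -- 1 + |r|.
  candidates : ℕ → ℕ → List A → List A → List A
  candidates zero    k w v       = []
  candidates (suc n) k w []      = []
  candidates (suc n) k w (a ∷ v) =
    if agree k w v then a ∷ candidates n (suc k) w v else candidates n (suc k) w v

  agree-sound : ∀ k u v → agree k u v ≡ true →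
                ∃ λ p → ∃₂ λ s t → length p ≡ k × u ≡ p ++ s × v ≡ p ++ t
  agree-sound zero    u       v       _  = [] , u , v , refl , refl , refl
  agree-sound (suc k) (a ∷ u) (b ∷ v) eq with a ≟ᴬ b
  ... | yes refl with p , s , t , refl , refl , refl ← agree-sound k u v eq =
    a ∷ p , s , t , refl , refl , refl

  agree-complete : ∀ p s t → agree (length p) (p ++ s) (p ++ t) ≡ true
  agree-complete []      s t = refl
  agree-complete (a ∷ p) s t with a ≟ᴬ a
  ... | yes _  = agree-complete p s t
  ... | no a≢a = contradiction refl a≢a

  candidates-sound : ∀ n k w v → a ∈ candidates n k w v →
                     ∃₂ λ r t → v ≡ r ++ a ∷ t × agree (length r + k) w t ≡ true
  candidates-sound (suc n) k w (b ∷ v) a∈ with agree k w v in eq | a∈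
  ... | true  | here refl = [] , v , refl , eq
  ... | true  | there a∈′ with r , t , refl , eq′ ← candidates-sound n (suc k) w v a∈′ =
    b ∷ r , t , refl , trans (cong (λ l → agree l w t) (sym (+-suc (length r) k))) eq′
  ... | false | a∈′ with r , t , refl , eq′ ← candidates-sound n (suc k) w v a∈′ =
    b ∷ r , t , refl , trans (cong (λ l → agree l w t) (sym (+-suc (length r) k))) eq′

  candidates-complete : ∀ {n} k w r {t} → length r < n → agree (length r + k) w t ≡ true →
                        a ∈ candidates n k w (r ++ a ∷ t)
  candidates-complete {n = suc n} k w []      _         eq rewrite eq = here refl
  candidates-complete {a = a} {n = suc n} k w (b ∷ r) {t} (s≤s r<n) eq
    with rest ← candidates-complete (suc k) w r r<n (trans (cong (λ l → agree l w t) (+-suc (length r) k)) eq)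
    with agree k w (r ++ a ∷ t)
  ... | true  = there rest
  ... | false = rest

  -- With `a` put in front, these factorizations read (a r)(a r) t and (a r)(a r) a t.
  SquareHead OverlapHead : A → List A → Set
  SquareHead  a w = ∃₂ λ r t → w ≡ r ++ a ∷ r ++ t
  OverlapHead a w = ∃₂ λ r t → w ≡ r ++ a ∷ r ++ a ∷ t

  squareHead-sound : ∀ {n w} → a ∈ candidates n 0 w w → SquareHead a w
  squareHead-sound {n = n} {w} a∈ with candidates-sound n 0 w w a∈
  ... | r , t , refl , eq with agree-sound _ w t eq
  ... | p , s , t′ , |p| , w≡p++s , refl
    -- `p` and `r` are prefixes of `w` of the same length, so they coincide and `t` begins with `r`.
    with refl , _ ← ++-injective p r (trans |p| (+-identityʳ _)) (sym w≡p++s) = r , t′ , refl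

  -- A square of period 1 + |r| at the head of a w takes up 2|r| + 1 letters of `w`. Hence 2|r| <
  -- 2n, and the period is within the search bound.
  squareHead-complete : length w ≤ n + n → SquareHead a w → a ∈ candidates n 0 w w
  squareHead-complete {n = n} {a = a} |w|≤n+n (r , t , refl) =
    candidates-complete 0 (r ++ a ∷ r ++ t) r (double-<⁻ |r|+|r|<n+n)
      (trans (cong (λ l → agree l (r ++ a ∷ r ++ t) (r ++ t)) (+-identityʳ (length r)))
             (agree-complete r (a ∷ r ++ t) t))
    where
    double-<⁻ : ∀ {l} → l + l < n + n → l < n
    double-<⁻ {l} lt with l ℕ.<? n
    ... | yes l<n = l<n
    ... | no  l≮n = contradiction (≤-trans lt (+-mono-≤ (≮⇒≥ l≮n) (≮⇒≥ l≮n))) 1+n≰n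

    |r|+|r|<n+n : length r + length r < n + n
    |r|+|r|<n+n = ≤-trans (≤-reflexive (sym (+-suc _ _)))
      (≤-trans (+-monoʳ-≤ (length r) (s≤s (≤-trans (m≤m+n _ (length t)) (≤-reflexive (sym (length-++ r))))))
      (≤-trans (≤-reflexive (sym (length-++ r))) |w|≤n+n))

  overlapHead-sound : a ∈ candidates n 1 w w → OverlapHead a w
  overlapHead-sound {a = a} {n = n} {w = w} a∈ with candidates-sound n 1 w w a∈
  ... | r , t , refl , eq with agree-sound _ w t eq
  ... | p , s , t′ , |p| , w≡p++s , refl
    -- The agreement is now one letter longer, so the common prefix `p` is r a, and `t` begins with
    -- r a.
    with refl , _ ← ++-injective p (r ∷ʳ a) (trans |p| (sym (length-++ r)))
                      (trans (sym w≡p++s) (sym (∷ʳ-++ r a _))) =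
    r , t′ , cong (λ y → r ++ a ∷ y) (∷ʳ-++ r a t′)

  -- The bound `length w` excludes no period, since `r` is a proper prefix of the word.
  overlapHead-complete : OverlapHead a w → a ∈ candidates (length w) 1 w w
  overlapHead-complete {a = a} (r , t , refl) =
    candidates-complete 1 o r r<w
      (begin
        agree (length r + 1) o (r ++ a ∷ t)                                ≡⟨ cong (λ l → agree l o (r ++ a ∷ t)) (length-++ r) ⟨
        agree (length (r ∷ʳ a)) o (r ++ a ∷ t)                             ≡⟨ cong₂ (agree (length (r ∷ʳ a))) (∷ʳ-++ r a _) (∷ʳ-++ r a t) ⟨
        agree (length (r ∷ʳ a)) (r ∷ʳ a ++ r ++ a ∷ t) (r ∷ʳ a ++ t)       ≡⟨ agree-complete (r ∷ʳ a) (r ++ a ∷ t) t ⟩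
        true                                                               ∎)
    where
    open ≡-Reasoning
    o = r ++ a ∷ r ++ a ∷ t
    r<w : length r < length o
    r<w = ≤-trans (s≤s (m≤m+n _ (length (r ++ a ∷ t))))
            (≤-reflexive (trans (sym (+-suc _ _)) (sym (length-++ r))))

  -- Every candidate comes from an actual overlap, whatever the bound `n`. This is why pruning with
  -- short periods only is sound.
  overlapFree⇒∉ : OverlapFree (a ∷ w) → a ∉ candidates n 1 w w
  overlapFree⇒∉ {a = a} {n = n} free a∈ with r , t , refl ← overlapHead-sound {n = n} a∈ =
    free (_ , (a , r , refl) , infix-++ [] t (cong (a ∷_) (begin
      r ++ a ∷ r ++ a ∷ t                ≡⟨ cong (λ y → r ++ a ∷ y) (∷ʳ-++ r a t) ⟨
      r ++ (a ∷ r ∷ʳ a) ++ t             ≡⟨ ++-assoc r (a ∷ r ∷ʳ a) t ⟨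
      (r ++ a ∷ r ∷ʳ a) ++ t             ∎)))
    where open ≡-Reasoning

  -- An overlap in a w either lies within `w` or starts at the new letter.
  ∉⇒overlapFree : OverlapFree w → a ∉ candidates (length w) 1 w w → OverlapFree (a ∷ w)
  ∉⇒overlapFree free a∉ (w′ , ov , Infix.there inf) = free (w′ , ov , inf)
  ∉⇒overlapFree {a = a} free a∉ (_ , (b , x , refl) , Infix.here pre) with s , refl ← prefix⇒++ pre =
    a∉ (overlapHead-complete (x , s , trans (++-assoc x (b ∷ x ∷ʳ b) s) (cong (λ y → x ++ b ∷ y) (∷ʳ-++ x b s))))

  overlapFree? : ∀ w → Dec (OverlapFree w)
  overlapFree? []      = yes λ { (_ , (_ , _ , refl) , Infix.here ()) }
  overlapFree? (a ∷ w) =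
    map′ (uncurry ∉⇒overlapFree) (λ free → overlapFree-tail free , overlapFree⇒∉ {n = length w} free)
         (overlapFree? w ×-dec ¬? (a ∈? candidates (length w) 1 w w))

-- The library's equality test computes the same bit in more steps, which the
-- search below would feel.
_≟₃_ : DecidableEquality (Fin 3)
0F ≟₃ 0F = yes refl
0F ≟₃ 1F = no λ ()
0F ≟₃ 2F = no λ ()
1F ≟₃ 0F = no λ ()
1F ≟₃ 1F = yes refl
1F ≟₃ 2F = no λ ()
2F ≟₃ 0F = no λ ()
2F ≟₃ 1F = no λ ()
2F ≟₃ 2F = yes refl

-- Curling numbers of words stored in reverse

module Letters = HeadRepetitions _≟₃_
module Curls   = HeadRepetitions ℕ._≟_

-- Words are built from the right, hence stored in reverse. The bound 42 on
-- periods loses nothing for words of length at most 85.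
curl : Fin 3 → List (Fin 3) → ℕ
curl a w = if does (a Letters.∈? Letters.candidates 42 0 w w) then 2 else 1

curls : List (Fin 3) → List ℕ
curls []      = []
curls (a ∷ w) = curl a w ∷ curls w

squareHead⇒endsInSquare : Letters.SquareHead a w → EndsInPower (reverse (a ∷ w)) 2
squareHead⇒endsInSquare {a = a} (r , t , refl) =
  reverse t , z , reverse-∷≢[] , (begin
    reverse (a ∷ r ++ a ∷ r ++ t)           ≡⟨ reverse-++ (a ∷ r) (a ∷ r ++ t) ⟩
    reverse (a ∷ r ++ t) ++ z               ≡⟨ cong (_++ z) (reverse-++ (a ∷ r) t) ⟩
    (reverse t ++ z) ++ z                   ≡⟨ ++-assoc (reverse t) z z ⟩
    reverse t ++ z ++ z                     ≡⟨ cong (λ y → reverse t ++ z ++ y) (++-identityʳ z) ⟨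
    reverse t ++ z ++ z ++ []               ∎)
  where
  open ≡-Reasoning
  z = reverse (a ∷ r)
  reverse-∷≢[] : z ≢ []
  reverse-∷≢[] eq with () ← reverse-injective {x = a ∷ r} {y = []} eq

endsInSquare⇒squareHead : EndsInPower (reverse (a ∷ w)) 2 → Letters.SquareHead a w
endsInSquare⇒squareHead {a = a} {w = w} (y , z , z≢[] , eq) = head (reverse z) refl (begin
  a ∷ w                                          ≡⟨ reverse-involutive (a ∷ w) ⟨
  reverse (reverse (a ∷ w))                      ≡⟨ cong reverse eq ⟩
  reverse (y ++ z ++ z ++ [])                    ≡⟨ cong (λ s → reverse (y ++ z ++ s)) (++-identityʳ z) ⟩
  reverse (y ++ z ++ z)                          ≡⟨ reverse-++ y (z ++ z) ⟩
  reverse (z ++ z) ++ reverse y                  ≡⟨ cong (_++ reverse y) (reverse-++ z z) ⟩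
  (reverse z ++ reverse z) ++ reverse y          ≡⟨ ++-assoc (reverse z) (reverse z) (reverse y) ⟩
  reverse z ++ reverse z ++ reverse y            ∎)
  where
  open ≡-Reasoning
  -- Splitting on `reverse z` exposes its first letter, which must be `a`; the empty case would make
  -- `z` empty.
  head : ∀ z′ → reverse z ≡ z′ → a ∷ w ≡ z′ ++ z′ ++ reverse y → Letters.SquareHead a w
  head []      z′≡ _    = contradiction (reverse-injective z′≡) z≢[]
  head (b ∷ r) _   refl = r , reverse y , refl

-- Without overlaps the curling number is 2 or 1 according to whether the word ends in a square. The
-- bound 84 = 2 · 42 ensures that no square is missed.
curl-correct : length w ≤ 84 → OverlapFree (a ∷ w) → curlingNumber _≟_ (reverse (a ∷ w)) ≡ curl a w
curl-correct {w = w} {a = a} |w|≤84 free = isCurlingNumber-unique (curlingNumber-correct _≟_ (reverse (a ∷ w)) u≢[]) isCurl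
  where
  u≢[] : reverse (a ∷ w) ≢ []
  u≢[] eq with () ← reverse-injective {x = a ∷ w} {y = []} eq
  isCurl : IsCurlingNumber (reverse (a ∷ w)) (curl a w)
  isCurl with a Letters.∈? Letters.candidates 42 0 w w
  ... | yes a∈ = overlapFree-square⇒2 (overlapFree-reverse free)
                   (squareHead⇒endsInSquare {w = w} (Letters.squareHead-sound {n = 42} {w} a∈))
  ... | no  a∉ = nonsquare⇒1 u≢[] λ e →
                   a∉ (Letters.squareHead-complete {w = w} {n = 42} |w|≤84 (endsInSquare⇒squareHead {w = w} e))

-- Appending a letter to the word appends one letter to the transform, namely the curling number of
-- the whole word.
curls-correct : length w ≤ 85 → OverlapFree w → curlingTransform _≟_ (reverse w) ≡ reverse (curls w)
curls-correct {w = []}    _            _    = refl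
curls-correct {w = a ∷ w} (s≤s |w|≤84) free = begin
  curlingTransform _≟_ (reverse (a ∷ w))                         ≡⟨ cong (curlingTransform _≟_) (unfold-reverse a w) ⟩
  curlingTransform _≟_ (reverse w ∷ʳ a)                          ≡⟨ prefixwise-++ (curlingNumber _≟_) (reverse w) [ a ] ⟩
  curlingTransform _≟_ (reverse w) ∷ʳ curlingNumber _≟_ (reverse w ∷ʳ a)
    ≡⟨ cong₂ _∷ʳ_ (curls-correct (≤-trans |w|≤84 (n≤1+n 84)) (overlapFree-tail free))
                  (trans (cong (curlingNumber _≟_) (sym (unfold-reverse a w))) (curl-correct {w = w} |w|≤84 free)) ⟩
  reverse (curls w) ∷ʳ curl a w                                  ≡⟨ unfold-reverse (curl a w) (curls w) ⟨
  reverse (curls (a ∷ w))                                        ∎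
  where open ≡-Reasoning

good⇒overlapFree-curls : length w ≤ 85 → Good (reverse w) → OverlapFree w × OverlapFree (curls w)
good⇒overlapFree-curls |w|≤85 (free , freeC) =
  free′ , overlapFree-reverse⁻ (subst OverlapFree (curls-correct |w|≤85 free′) freeC)
  where free′ = overlapFree-reverse⁻ free

-- The backtracking search and its soundness

allLetters : (Fin 3 → Bool) → Bool
allLetters p = p 0F ∧ p 1F ∧ p 2F

allLetters⁻ : ∀ p → allLetters p ≡ true → ∀ a → p a ≡ true
allLetters⁻ p eq a with p 0F in p0 | p 1F in p1 | p 2F in p2
allLetters⁻ p eq 0F | true | true | true = p0
allLetters⁻ p eq 1F | true | true | true = p1
allLetters⁻ p eq 2F | true | true | true = p2

-- refuted n w (curls w) implies that reverse w has no good extension by n letters.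
-- Pruning only on overlaps of period at most 12 in the word and 24 in its
-- transform is cheaper, and suffices.
refuted : ℕ → List (Fin 3) → List ℕ → Bool
-- The candidate lists are arguments so that the three letters tried at a node share them; `extend`
-- likewise receives the curling number `k` once for both of its uses.
branch  : ℕ → (w : List (Fin 3)) (c : List ℕ) (squares overlaps : List (Fin 3)) (overlapsC : List ℕ) → Fin 3 → Bool
extend  : ℕ → (w : List (Fin 3)) (c : List ℕ) (overlapsC : List ℕ) → Fin 3 → ℕ → Bool

-- A branch that reaches full length defeats the refutation, so `true` means that every branch was
-- pruned.
refuted zero    w c = false
refuted (suc n) w c =
  allLetters (branch n w c (Letters.candidates 42 0 w w) (Letters.candidates 12 1 w w) (Curls.candidates 24 1 c c))

branch n w c squares overlaps overlapsC a =
  does (a Letters.∈? overlaps) ∨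
  extend n w c overlapsC a (if does (a Letters.∈? squares) then 2 else 1)

extend n w c overlapsC a k = does (k Curls.∈? overlapsC) ∨ refuted n (a ∷ w) (k ∷ c)

does-∨⁻ : ∀ {P : Set} {q} (p? : Dec P) → ¬ P → does p? ∨ q ≡ true → q ≡ true
does-∨⁻ (yes p) ¬p _  = contradiction p ¬p
does-∨⁻ (no _)  _  eq = eq

-- Neither pruning test can fire at a child whose word and transform are overlap-free, so the value
-- `true` must come from the recursive call.
refuted-step : ∀ n w c a → OverlapFree (a ∷ w) → OverlapFree (curl a w ∷ c) →
               refuted (suc n) w c ≡ true → refuted n (a ∷ w) (curl a w ∷ c) ≡ true
refuted-step n w c a free freeC eq =
  does-∨⁻ (curl a w Curls.∈? overlapsC) (Curls.overlapFree⇒∉ {n = 24} freeC)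
    (does-∨⁻ (a Letters.∈? overlaps) (Letters.overlapFree⇒∉ {n = 12} free)
      (allLetters⁻ (branch n w c squares overlaps overlapsC) eq a))
  where
  squares   = Letters.candidates 42 0 w w
  overlaps  = Letters.candidates 12 1 w w
  overlapsC = Curls.candidates 24 1 c c

refuted-sound : ∀ n w → length w + n ≤ 85 → refuted n w (curls w) ≡ true →
                ∀ v → length v ≡ n → ¬ Good (w ʳ++ v)
-- The case n = 0 is absurd, because `refuted zero` is `false`.
refuted-sound (suc n) w |w|+n≤85 eq (a ∷ v) |v|≡n good =
  -- `w ʳ++ (a ∷ v)` and `(a ∷ w) ʳ++ v` are definitionally equal, so `good` passes to the child
  -- unchanged.
  refuted-sound n (a ∷ w) |aw|+n≤85 (refuted-step n w (curls w) a free freeC eq) v (suc-injective |v|≡n) good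
  where
  |aw|+n≤85 : length (a ∷ w) + n ≤ 85
  |aw|+n≤85 = ≤-trans (≤-reflexive (sym (+-suc (length w) n))) |w|+n≤85

  frees : OverlapFree (a ∷ w) × OverlapFree (curls (a ∷ w))
  frees = good⇒overlapFree-curls (≤-trans (m≤m+n _ n) |aw|+n≤85)
            (good-++ˡ (reverse (a ∷ w)) (subst Good (ʳ++-defn (a ∷ w)) good))

  free  = proj₁ frees
  freeC = proj₂ frees

-- Reduction to words that begin with 01 or 001

relabelling : Fin 3 → Fin 3 → Permutation′ 3
relabelling a b = transpose a 0F ∘ₚ transpose (transpose a 0F ⟨$⟩ʳ b) 1F

-- The first transposition moves `a` to 0. The image of `b` is then not 0, so exchanging it with 1
-- leaves 0 fixed.
relabelling-correct : ∀ a b → a ≢ b → relabelling a b ⟨$⟩ʳ a ≡ 0F × relabelling a b ⟨$⟩ʳ b ≡ 1F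
relabelling-correct = from-yes (all? λ a → all? λ b →
  ¬? (a ≟ b) →-dec ((relabelling a b ⟨$⟩ʳ a ≟ 0F) ×-dec (relabelling a b ⟨$⟩ʳ b ≟ 1F)))

-- The stored list is the word 01 backwards, and 83 more letters give length 85. Checking `refl`
-- runs the search.
refuted-01 : refuted 83 (1F ∷ 0F ∷ []) (curls (1F ∷ 0F ∷ [])) ≡ true
refuted-01 = refl

refuted-001 : refuted 82 (1F ∷ 0F ∷ 0F ∷ []) (curls (1F ∷ 0F ∷ 0F ∷ [])) ≡ true
refuted-001 = refl

good-permute : (π : Permutation′ 3) → Good u → Good (map (π ⟨$⟩ʳ_) u)
good-permute π = good-map {g = π ⟨$⟩ˡ_} (λ _ → inverseˡ π)

no-good-85 : ∀ x → length x ≡ 85 → ¬ Good x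
no-good-85 (a ∷ b ∷ c ∷ v) |x|≡85 good with a ≟ b | a ≟ c
... | no a≢b | _ =
  let π           = relabelling a b
      πa≡0 , πb≡1 = relabelling-correct a b a≢b
  in refuted-sound 83 (1F ∷ 0F ∷ []) ≤-refl refuted-01 (map (π ⟨$⟩ʳ_) (c ∷ v))
       (trans (length-map _ (c ∷ v)) (suc-injective (suc-injective |x|≡85)))
       (subst Good (cong₂ (λ p q → p ∷ q ∷ map (π ⟨$⟩ʳ_) (c ∷ v)) πa≡0 πb≡1) (good-permute π good))
... | yes refl | no a≢c =
  let π           = relabelling a c
      πa≡0 , πc≡1 = relabelling-correct a c a≢c
  in refuted-sound 82 (1F ∷ 0F ∷ 0F ∷ []) ≤-refl refuted-001 (map (π ⟨$⟩ʳ_) v)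
       (trans (length-map _ v) (suc-injective (suc-injective (suc-injective |x|≡85))))
       (subst Good (cong₂ (λ p q → p ∷ p ∷ q ∷ map (π ⟨$⟩ʳ_) v) πa≡0 πc≡1) (good-permute π good))
-- Three equal letters form the overlap a x a x a with x empty.
... | yes refl | yes refl = proj₁ good (_ , (a , [] , refl) , infix-++ [] v refl)

-- A word of length 84, and the conclusion

longest : List (Fin 3)
longest =
  0F ∷ 0F ∷ 1F ∷ 1F ∷ 2F ∷ 0F ∷ 2F ∷ 2F ∷ 1F ∷ 1F ∷ 0F ∷ 2F ∷ 2F ∷ 1F ∷
  1F ∷ 2F ∷ 0F ∷ 0F ∷ 1F ∷ 2F ∷ 0F ∷ 0F ∷ 2F ∷ 0F ∷ 0F ∷ 1F ∷ 1F ∷ 2F ∷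
  1F ∷ 2F ∷ 0F ∷ 2F ∷ 0F ∷ 0F ∷ 2F ∷ 0F ∷ 1F ∷ 1F ∷ 0F ∷ 1F ∷ 1F ∷ 2F ∷
  0F ∷ 2F ∷ 0F ∷ 0F ∷ 2F ∷ 0F ∷ 1F ∷ 0F ∷ 0F ∷ 1F ∷ 0F ∷ 1F ∷ 1F ∷ 2F ∷
  0F ∷ 0F ∷ 1F ∷ 2F ∷ 0F ∷ 0F ∷ 2F ∷ 0F ∷ 0F ∷ 1F ∷ 1F ∷ 2F ∷ 1F ∷ 2F ∷
  0F ∷ 2F ∷ 0F ∷ 0F ∷ 2F ∷ 0F ∷ 1F ∷ 0F ∷ 0F ∷ 1F ∷ 0F ∷ 1F ∷ 1F ∷ 0F ∷ []

-- `longest` is stored backwards, as in the search. Its transform is evaluated through `curls`, and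
-- the overlap tests here cover all periods.
longest-correct : length longest ≡ 84 × Good (reverse longest)
longest-correct = refl , overlapFree-reverse free ,
  subst OverlapFree (sym (curls-correct {w = longest} (n≤1+n 84) free)) (overlapFree-reverse (from-yes (Curls.overlapFree? (curls longest))))
  where
  free : OverlapFree longest
  free = from-yes (Letters.overlapFree? longest)

theorem7 : (∃ λ (x : List (Fin 3)) →
    length x ≡ 84 × OverlapFree x × OverlapFree (curlingTransform _≟_ x))
    × ¬ (∃ λ (x : List (Fin 3)) →
    84 < length x × OverlapFree x × OverlapFree (curlingTransform _≟_ x))
theorem7 = (reverse longest , trans (length-reverse longest) |longest|≡84 , good) , none
  where
  |longest|≡84 = proj₁ longest-correct
  good         = proj₂ longest-correct

  none : ¬ (∃ λ x → 84 < length x × Good x)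
  none (x , 84<|x| , good) =
    -- A longer good word would have a good prefix of length exactly 85, since `84 < length x`
    -- unfolds to `85 ≤ length x`.
    no-good-85 (take 85 x) (trans (length-take 85 x) (m≤n⇒m⊓n≡m 84<|x|))
      (good-++ˡ (take 85 x) (subst Good (sym (take++drop≡id 85 x)) good))
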